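{- Algorithm \textsf{A} (defined below), run on an undirected graph with vertex set $[n]$, takes $O(d)$ steps, where $d$ is the maximum of the diameters of the connected components of the input graph.
   Context: Each edge $e$ has two ends $e.v,e.w$; the current edge set is initially the input edge set. Each vertex $v$ has a parent $v.p$, initially $v$. Vertices are compared as integers. Each operation is performed simultaneously for all edges/vertices using values at the start of the operation. \textsc{connect}: for each current edge $e$, send $\min\{e.v,e.w\}$ to $\max\{e.v,e.w\}$. \textsc{update}: for each vertex $v$, replace $v.p$ by the minimum of $v.p$ and the vertices sent to $v$ in the preceding \textsc{connect}. \textsc{shortcut}: for each vertex $v$, replace $v.p$ by $(v.p).p$. \textsc{alter}: for each edge $e$, let $x=e.v.p$, $y=e.w.p$; if $x=y$ delete $e$, else replace $e.v,e.w$ by $x,y$. Algorithm \textsf{A}: repeat \{\textsc{connect}; \textsc{update}; \textsc{shortcut}; \textsc{alter}\} until no parent changes. Each iteration is a round; a round consists of a constant number of synchronous concurrent message-passing steps, so the number of steps is within a constant factor of the number of rounds. -}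

module Defs where

open import Data.Nat using (ℕ; zero; suc; _<_)
open import Data.Fin using (Fin)
open import Data.Fin.Properties using (_≟_; _≤?_)
open import Data.Product using (_×_; _,_; proj₁; proj₂; Σ; ∃)
open import Data.Sum using (_⊎_)
open import Data.List using (List; []; _∷_; foldr)
open import Data.List.Membership.Propositional using (_∈_)
open import Relation.Nullary using (¬_; yes; no)
open import Relation.Binary.PropositionalEquality using (_≡_)

-- An (undirected) edge on vertex set [n] = Fin n is an unordered pair,
-- represented by its two ends e.v , e.w.
Edge : ℕ → Set
Edge n = Fin n × Fin n

Graph : ℕ → Set
Graph n = List (Edge n)

Parents : ℕ → Set
Parents n = Fin n → Fin n

minF : ∀ {n} → Fin n → Fin n → Fin n
minF a b with a ≤? b
... | yes _ = a
... | no  _ = b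

maxF : ∀ {n} → Fin n → Fin n → Fin n
maxF a b with a ≤? b
... | yes _ = b
... | no  _ = a

-- CONNECT followed by UPDATE: every current edge e sends min{e.v,e.w} to
-- max{e.v,e.w}; each vertex v replaces v.p by the minimum of v.p and all
-- values sent to v.
connectUpdate : ∀ {n} → Graph n → Parents n → Parents n
connectUpdate E p v = foldr step (p v) E
  where
  step : _ → Fin _ → Fin _
  step (a , b) acc with maxF a b ≟ v
  ... | yes _ = minF (minF a b) acc
  ... | no  _ = acc

shortcut : ∀ {n} → Parents n → Parents n
shortcut p v = p (p v)

alter : ∀ {n} → Parents n → Graph n → Graph n
alter p [] = []
alter p ((a , b) ∷ E) with p a ≟ p b
... | yes _ = alter p E
... | no  _ = (p a , p b) ∷ alter p E

State : ℕ → Set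
State n = Parents n × Graph n

round : ∀ {n} → State n → State n
round (p , E) =
  let p₂ = shortcut (connectUpdate E p) in (p₂ , alter p₂ E)

initial : ∀ {n} → Graph n → State n
initial E = ((λ v → v) , E)

after : ∀ {n} → Graph n → ℕ → State n
after G zero    = initial G
after G (suc k) = round (after G k)

NoParentChanges : ∀ {n} → Graph n → ℕ → Set
NoParentChanges G j = ∀ v → proj₁ (after G (suc j)) v ≡ proj₁ (after G j) v

-- Algorithm A (repeat rounds until no parent changes) halts after exactly
-- r rounds: r = suc m where round suc m is the first round in which no
-- parent changes.
HaltsAfter : ∀ {n} → Graph n → ℕ → Set
HaltsAfter G r =
  Σ ℕ λ m → (r ≡ suc m) × NoParentChanges G m × (∀ j → j < m → ¬ NoParentChanges G j)

Adj : ∀ {n} → Graph n → Fin n → Fin n → Set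
Adj G u w = ((u , w) ∈ G) ⊎ ((w , u) ∈ G)

data Walk {n} (G : Graph n) : Fin n → Fin n → ℕ → Set where
  here : ∀ {u} → Walk G u u zero
  step : ∀ {u w v k} → Adj G u w → Walk G w v k → Walk G u v (suc k)

Dist : ∀ {n} → Graph n → Fin n → Fin n → ℕ → Set
Dist G u v k = Walk G u v k × (∀ j → j < k → ¬ Walk G u v j)

-- d = maximum of the diameters of the connected components of G
--   = maximum of dist(u,v) over all pairs u,v in a common component.
MaxComponentDiameter : ∀ {n} → Graph n → ℕ → Set
MaxComponentDiameter {n} G d =
  (∀ (u v : Fin n) k → Dist G u v k → k Data.Nat.≤ d) × ∃ λ u → ∃ λ v → Dist G u v d

Loopless : ∀ {n} → Graph n → Set
Loopless G = ∀ {a b} → (a , b) ∈ G → ¬ a ≡ b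

{-# OPTIONS --safe #-}
-- Let p k be the parent map after k rounds and let carry k a be the vertex to
-- which the alterations of the first k rounds have moved the end a of an input
-- edge, so that carry (suc k) = p (suc k) ∘ carry k.  A vertex at distance k
-- from the minimum u of its component has carry k a ≡ u, because the end of an
-- altered edge with other end u receives u as its parent.  Hence the image
-- Im k of carry k consists of the component minima once k ≥ d.  The sets Im k
-- decrease, and p k maps Im j into Im (suc j) for j < k, so the trees have depth
-- at most d after d rounds; from then on only the shortcuts act, and at most d
-- of them flatten the trees.
module Submission where

open import Defs
open import Data.Nat using (ℕ; zero; suc; _*_; _+_; _≤_; _<_; s≤s)
open import Data.Nat.Properties as ℕₚ using (anyUpTo?)
open import Data.Nat.Induction using (<-wellFounded)
open import Data.Nat.Tactic.RingSolver using (solve-∀)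
open import Data.Fin as Fin using (Fin; toℕ)
open import Data.Fin.Properties as Finₚ using (_≟_; _≤?_; any?; all?)
open import Data.List using (List; []; _∷_; foldr)
open import Data.List.Membership.Propositional using (_∈_)
import Data.List.Membership.DecPropositional as DecMembership
open import Data.List.Relation.Unary.Any using (here; there)
open import Data.Product using (_×_; _,_; proj₁; proj₂; Σ; ∃; ∃₂)
open import Data.Product.Properties using (≡-dec)
open import Data.Sum using (_⊎_; inj₁; inj₂; swap; map₂)
open import Function using (_∘_)
open import Induction.WellFounded using (Acc; acc)
open import Relation.Nullary using (¬_; Dec; yes; no; contradiction)
open import Relation.Nullary.Decidable using (map′; _×-dec_; _⊎-dec_)
open import Relation.Binary.PropositionalEquality
  using (_≡_; refl; sym; trans; cong; cong₂; subst)

private variable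
  n : ℕ
  A B : Set

-- Searching, folding and summing.

least : {P : ℕ → Set} → (∀ m → Dec (P m)) → ∀ {k} → P k →
        ∃ λ m → P m × (∀ j → j < m → ¬ P j)
least {P} P? {k} = go (<-wellFounded k)
  where
  go : ∀ {k} → Acc _<_ k → P k → ∃ λ m → P m × (∀ j → j < m → ¬ P j)
  go {k} (acc rs) Pk with anyUpTo? P? k
  ... | no none = k , Pk , λ j j<k Pj → none (j , j<k , Pj)
  ... | yes (i , i<k , Pi) = go (rs i<k) Pi

foldr-reaches : (P : B → Set) (f : A → B → B) {e : B} {x : A} →
                (∀ x y → P y → P (f x y)) → (∀ y → P (f x y)) →
                ∀ {xs} → x ∈ xs → P (foldr f e xs)
foldr-reaches P f pres reach (here refl) = reach _
foldr-reaches P f pres reach (there x∈)  = pres _ _ (foldr-reaches P f pres reach x∈)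

weight : (Fin n → ℕ) → ℕ
weight {zero}  f = 0
weight {suc n} f = f Fin.zero + weight (f ∘ Fin.suc)

-- Serves termination: it turns a pointwise decrease of the parents into a descent in the natural
-- numbers.
weight-≤⇒≡⊎< : {f g : Fin n → ℕ} → (∀ i → f i ≤ g i) →
               (∀ i → f i ≡ g i) ⊎ weight f < weight g
weight-≤⇒≡⊎< {zero}  f≤g = inj₁ λ ()
weight-≤⇒≡⊎< {suc n} {f} {g} f≤g
  with ℕₚ.m≤n⇒m<n∨m≡n (f≤g Fin.zero) | weight-≤⇒≡⊎< (f≤g ∘ Fin.suc)
... | inj₂ f₀≡g₀ | inj₁ f≡g = inj₁ λ { Fin.zero → f₀≡g₀ ; (Fin.suc i) → f≡g i }
... | inj₂ f₀≡g₀ | inj₂ f<g = inj₂ (ℕₚ.+-mono-≤-< (ℕₚ.≤-reflexive f₀≡g₀) f<g)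
... | inj₁ f₀<g₀ | inj₂ f<g = inj₂ (ℕₚ.+-mono-< f₀<g₀ f<g)
... | inj₁ f₀<g₀ | inj₁ f≡g =
  inj₂ (ℕₚ.+-mono-<-≤ f₀<g₀ (ℕₚ.≤-reflexive (weight-cong f≡g)))
  where
  weight-cong : ∀ {n} {f g : Fin n → ℕ} → (∀ i → f i ≡ g i) → weight f ≡ weight g
  weight-cong {zero}  eq = refl
  weight-cong {suc n} eq = cong₂ _+_ (eq Fin.zero) (weight-cong (eq ∘ Fin.suc))

-- One round

minF-≤ˡ : (a b : Fin n) → minF a b Fin.≤ a
minF-≤ˡ a b with a ≤? b
... | yes _   = ℕₚ.≤-refl
... | no  a≰b = ℕₚ.≰⇒≥ a≰b

minF-≤ʳ : (a b : Fin n) → minF a b Fin.≤ b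
minF-≤ʳ a b with a ≤? b
... | yes a≤b = a≤b
... | no  _   = ℕₚ.≤-refl

minF-sel : (a b : Fin n) → minF a b ≡ a ⊎ minF a b ≡ b
minF-sel a b with a ≤? b
... | yes _ = inj₁ refl
... | no  _ = inj₂ refl

maxF-≤ : (a b : Fin n) → a Fin.≤ b → maxF a b ≡ b
maxF-≤ a b a≤b with a ≤? b
... | yes _   = refl
... | no  a≰b = contradiction a≤b a≰b

maxF-≥ : (a b : Fin n) → b Fin.≤ a → maxF a b ≡ a
maxF-≥ a b b≤a with a ≤? b
... | yes a≤b = Finₚ.≤-antisym b≤a a≤b
... | no  _   = refl

minF-maxF : (a b : Fin n) → (minF a b , maxF a b) ≡ (a , b) ⊎ (maxF a b , minF a b) ≡ (a , b)
minF-maxF a b with a ≤? b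
... | yes _ = inj₁ refl
... | no  _ = inj₂ refl

module _ (E : Graph n) (p : Parents n) (v : Fin n) where

  -- The folded function is local to connectUpdate; the first component names it.
  receiving : Σ (Edge n → Fin n → Fin n) λ f → connectUpdate E p v ≡ foldr f (p v) E
  receiving = _ , refl

  receive : Edge n → Fin n → Fin n
  receive = proj₁ receiving

  receive-≤ : ∀ e r → receive e r Fin.≤ r
  receive-≤ (a , b) r with maxF a b ≟ v
  ... | yes _ = minF-≤ʳ (minF a b) r
  ... | no  _ = ℕₚ.≤-refl

  receive-≤-minF : ∀ a b → maxF a b ≡ v → ∀ r → receive (a , b) r Fin.≤ minF a b
  receive-≤-minF a b max≡v r with maxF a b ≟ v
  ... | yes _     = minF-≤ˡ (minF a b) r
  ... | no  max≢v = contradiction max≡v max≢v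

  -- The equations between pairs cover both orientations of the edge and have the form in which
  -- `here` accepts them as membership proofs.
  receive-sel : ∀ a b r → receive (a , b) r ≡ r ⊎
    (receive (a , b) r , v) ≡ (a , b) ⊎ (v , receive (a , b) r) ≡ (a , b)
  receive-sel a b r with maxF a b ≟ v
  ... | no  _    = inj₁ refl
  ... | yes refl with minF-sel (minF a b) r
  ...   | inj₂ eq = inj₁ eq
  ...   | inj₁ eq rewrite eq = inj₂ (minF-maxF a b)

  connectUpdate-≤ : connectUpdate E p v Fin.≤ p v
  connectUpdate-≤ = go E
    where
    go : ∀ F → foldr receive (p v) F Fin.≤ p v
    go []      = ℕₚ.≤-refl
    go (e ∷ F) = ℕₚ.≤-trans (receive-≤ e _) (go F)

  -- The edge to `w` sends `w` to `v`, and whatever the fold takes in afterwards can only lower the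
  -- value.
  connectUpdate-≤-adj : ∀ {w} → Adj E v w → w Fin.≤ v → connectUpdate E p v Fin.≤ w
  connectUpdate-≤-adj {w} (inj₁ vw∈) w≤v =
    foldr-reaches (Fin._≤ w) receive (λ e y → ℕₚ.≤-trans (receive-≤ e y))
      (λ y → ℕₚ.≤-trans (receive-≤-minF v w (maxF-≥ v w w≤v) y) (minF-≤ʳ v w)) vw∈
  connectUpdate-≤-adj {w} (inj₂ wv∈) w≤v =
    foldr-reaches (Fin._≤ w) receive (λ e y → ℕₚ.≤-trans (receive-≤ e y))
      (λ y → ℕₚ.≤-trans (receive-≤-minF w v (maxF-≤ w v w≤v) y) (minF-≤ˡ w v)) wv∈

  connectUpdate-sel : connectUpdate E p v ≡ p v ⊎ Adj E v (connectUpdate E p v)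
  connectUpdate-sel = go E
    where
    go : ∀ F → foldr receive (p v) F ≡ p v ⊎ Adj F v (foldr receive (p v) F)
    go [] = inj₁ refl
    go ((a , b) ∷ F) with receive-sel a b (foldr receive (p v) F)
    ... | inj₂ (inj₁ eq) = inj₂ (inj₂ (here eq))
    ... | inj₂ (inj₂ eq) = inj₂ (inj₁ (here eq))
    ... | inj₁ eq rewrite eq with go F
    ...   | inj₁ same       = inj₁ same
    ...   | inj₂ (inj₁ vw∈) = inj₂ (inj₁ (there vw∈))
    ...   | inj₂ (inj₂ wv∈) = inj₂ (inj₂ (there wv∈))

∈-alter⁺ : (p : Parents n) {E : Graph n} {x y : Fin n} → (x , y) ∈ E →
           p x ≡ p y ⊎ (p x , p y) ∈ alter p E
∈-alter⁺ p {(a , b) ∷ E} xy∈ with p a ≟ p b | xy∈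
... | yes eq | here refl = inj₁ eq
... | no  _  | here refl = inj₂ (here refl)
... | yes _  | there xy∈′ = ∈-alter⁺ p xy∈′
... | no  _  | there xy∈′ = map₂ there (∈-alter⁺ p xy∈′)

∈-alter⁻ : (p : Parents n) (E : Graph n) {x y : Fin n} → (x , y) ∈ alter p E →
           ∃₂ λ a b → (a , b) ∈ E × x ≡ p a × y ≡ p b
∈-alter⁻ p ((a , b) ∷ E) xy∈ with p a ≟ p b
∈-alter⁻ p ((a , b) ∷ E) (here refl) | no _ = a , b , here refl , refl , refl
∈-alter⁻ p ((a , b) ∷ E) (there xy∈) | no _ =
  let a′ , b′ , ab∈ , eqs = ∈-alter⁻ p E xy∈ in a′ , b′ , there ab∈ , eqs
∈-alter⁻ p ((a , b) ∷ E) xy∈ | yes _ =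
  let a′ , b′ , ab∈ , eqs = ∈-alter⁻ p E xy∈ in a′ , b′ , there ab∈ , eqs

-- The sequence of parent maps and its termination.

module _ (G : Graph n) where

  p : ℕ → Parents n
  p k = proj₁ (after G k)

  edges : ℕ → Graph n
  edges k = proj₂ (after G k)

  -- The parent map of round suc k between update and shortcut.
  q : ℕ → Parents n
  q k = connectUpdate (edges k) (p k)

  p-≤ : ∀ k v → p k v Fin.≤ v
  q-≤ : ∀ k v → q k v Fin.≤ v
  p-≤ zero    v = ℕₚ.≤-refl
  p-≤ (suc k) v = ℕₚ.≤-trans (q-≤ k (q k v)) (q-≤ k v)
  q-≤ k v = ℕₚ.≤-trans (connectUpdate-≤ (edges k) (p k) v) (p-≤ k v)

  p-decreasing : ∀ k v → p (suc k) v Fin.≤ p k v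
  p-decreasing k v =
    ℕₚ.≤-trans (q-≤ k (q k v)) (connectUpdate-≤ (edges k) (p k) v)

  NoParentChanges? : ∀ k → Dec (NoParentChanges G k)
  NoParentChanges? k = all? λ v → p (suc k) v ≟ p k v

  -- The sum of the parents, read as numbers, drops in every round that changes a parent. The
  -- diameter does not enter, because `r` has to be chosen before `d` is given.
  terminates : ∃ (NoParentChanges G)
  terminates = go 0 (<-wellFounded _)
    where
    go : ∀ k → Acc _<_ (weight (toℕ ∘ p k)) → ∃ (NoParentChanges G)
    go k (acc rs) with weight-≤⇒≡⊎< (p-decreasing k)
    ... | inj₁ same  = k , Finₚ.toℕ-injective ∘ same
    ... | inj₂ drops = go (suc k) (rs drops)

  -- Images of the input vertices

  carry : ℕ → Parents n
  carry zero    a = a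
  carry (suc k) a = p (suc k) (carry k a)

  Im : ℕ → Fin n → Set
  Im k x = ∃ λ a → x ≡ carry k a

  -- An edge is deleted only when its ends merge, and merged ends stay merged.
  edges-carry⁺ : ∀ k {a b} → (a , b) ∈ G →
                 carry k a ≡ carry k b ⊎ (carry k a , carry k b) ∈ edges k
  edges-carry⁺ zero    ab∈ = inj₂ ab∈
  edges-carry⁺ (suc k) ab∈ with edges-carry⁺ k ab∈
  ... | inj₁ eq  = inj₁ (cong (p (suc k)) eq)
  ... | inj₂ ab∈ = ∈-alter⁺ (p (suc k)) ab∈

  edges-carry⁻ : ∀ k {x y} → (x , y) ∈ edges k →
                 ∃₂ λ a b → (a , b) ∈ G × x ≡ carry k a × y ≡ carry k b
  edges-carry⁻ zero    xy∈ = _ , _ , xy∈ , refl , refl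
  edges-carry⁻ (suc k) xy∈ with ∈-alter⁻ (p (suc k)) (edges k) xy∈
  ... | a , b , ab∈ , refl , refl with edges-carry⁻ k ab∈
  ...   | a′ , b′ , ab∈′ , refl , refl = a′ , b′ , ab∈′ , refl , refl

  Adj-carry⁺ : ∀ k {a b} → Adj G a b →
               carry k a ≡ carry k b ⊎ Adj (edges k) (carry k a) (carry k b)
  Adj-carry⁺ k (inj₁ ab∈) = map₂ inj₁ (edges-carry⁺ k ab∈)
  Adj-carry⁺ k (inj₂ ba∈) with edges-carry⁺ k ba∈
  ... | inj₁ eq  = inj₁ (sym eq)
  ... | inj₂ yx∈ = inj₂ (inj₂ yx∈)

  Adj-carry⁻ : ∀ k {x y} → Adj (edges k) x y →
               ∃₂ λ a b → Adj G a b × x ≡ carry k a × y ≡ carry k b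
  Adj-carry⁻ k (inj₁ xy∈) =
    let a , b , ab∈ , x≡ , y≡ = edges-carry⁻ k xy∈ in a , b , inj₁ ab∈ , x≡ , y≡
  Adj-carry⁻ k (inj₂ yx∈) =
    let b , a , ba∈ , y≡ , x≡ = edges-carry⁻ k yx∈ in a , b , inj₂ ba∈ , x≡ , y≡

  q-sel : ∀ k v → q k v ≡ p k v ⊎ Im k (q k v)
  q-sel k v with connectUpdate-sel (edges k) (p k) v
  ... | inj₁ eq  = inj₁ eq
  ... | inj₂ adj = let _ , b , _ , _ , eq = Adj-carry⁻ k adj in inj₂ (b , eq)

  -- One induction on `k`: a parent changed by `q k` is an end of a current edge and so lies in
  -- `Im k`, and `p (suc k)` is `q k` applied twice, which gives the inclusion needed for
  -- `p-Im (suc k)`.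
  p-Im      : ∀ k {x} → Im k x → Im k (p k x)
  q-Im      : ∀ k {x} → Im k x → Im k (q k x)
  Im-antitone-suc : ∀ k {x} → Im (suc k) x → Im k x
  p-Im zero    _   = _ , refl
  p-Im (suc k) x∈@(_ , refl) with Im-antitone-suc k x∈
  ... | b , eq = b , cong (p (suc k)) eq
  q-Im k {x} x∈ with q-sel k x
  ... | inj₁ eq = subst (Im k) (sym eq) (p-Im k x∈)
  ... | inj₂ q∈ = q∈
  Im-antitone-suc k (a , refl) = q-Im k (q-Im k (a , refl))

  Im-antitone : ∀ {j k} → j ≤ k → ∀ {x} → Im k x → Im j x
  Im-antitone {k = k} j≤k x∈ with ℕₚ.m≤n⇒m<n∨m≡n j≤k
  Im-antitone             _   x∈ | inj₂ refl = x∈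
  Im-antitone {k = suc k} _   x∈ | inj₁ (s≤s j≤k) = Im-antitone j≤k (Im-antitone-suc k x∈)

  -- For the newest image this is the definition of `carry`. For an older one, the first `q k` gains
  -- a level, either by induction or by landing in `Im k`; the second need only preserve it.
  p-Im-suc : ∀ k {j} → j < k → ∀ {x} → Im j x → Im (suc j) (p k x)
  p-Im-suc (suc k) {j} (s≤s j≤k) {x} x∈ with ℕₚ.m≤n⇒m<n∨m≡n j≤k
  ... | inj₂ refl = let a , eq = x∈ in a , cong (p (suc k)) eq
  ... | inj₁ j<k  = q-Im-suc q∈
    where
    q∈ : Im (suc j) (q k x)
    q∈ with q-sel k x
    ... | inj₁ eq = subst (Im (suc j)) (sym eq) (p-Im-suc k j<k x∈)
    ... | inj₂ q∈ = Im-antitone j<k q∈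
    q-Im-suc : ∀ {y} → Im (suc j) y → Im (suc j) (q k y)
    q-Im-suc {y} y∈ with q-sel k y | ℕₚ.m≤n⇒m<n∨m≡n j<k
    ... | inj₂ q∈ | _          = Im-antitone j<k q∈
    ... | inj₁ eq | inj₂ refl  = subst (Im k) (sym eq) (p-Im k y∈)
    ... | inj₁ eq | inj₁ j+1<k =
      subst (Im (suc j)) (sym eq) (Im-antitone-suc (suc j) (p-Im-suc k j+1<k y∈))

  -- Component minima

  Adj? : ∀ a b → Dec (Adj G a b)
  Adj? a b = (a , b) ∈? G ⊎-dec (b , a) ∈? G
    where open DecMembership (≡-dec _≟_ _≟_) using (_∈?_)

  Walk? : ∀ k a b → Dec (Walk G a b k)
  Walk? zero    a b = map′ (λ { refl → here }) (λ { here → refl }) (a ≟ b)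
  Walk? (suc k) a b =
    map′ (λ { (_ , adj , w) → step adj w }) (λ { (step adj w) → _ , adj , w })
      (any? λ c → Adj? a c ×-dec Walk? k c b)

  module _ (d : ℕ) (dist-≤ : ∀ u v k → Dist G u v k → k ≤ d) where

    -- The length bound makes reachability decidable by finite search. It excludes no vertex of the
    -- component, since a shortest walk has length at most `d`.
    Reach : Fin n → Fin n → Set
    Reach a b = ∃ λ k → k < suc d × Walk G a b k

    walk⇒reach : ∀ {a b k} → Walk G a b k → Reach a b
    walk⇒reach {a} {b} w with least (λ k → Walk? k a b) w
    ... | m , w′ , shortest = m , s≤s (dist-≤ a b m (w′ , shortest)) , w′

    component-min : ∀ a → ∃ λ u → Reach a u × (∀ v → Reach a v → u Fin.≤ v)
    component-min a
      with least {P = λ m → ∃ λ u → toℕ u ≡ m × Reach a u}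
             (λ m → any? λ u → toℕ u ℕₚ.≟ m ×-dec anyUpTo? (λ k → Walk? k a u) (suc d))
             (a , refl , walk⇒reach here)
    ... | _ , (u , refl , a⇝u) , lowest =
      u , a⇝u , λ v a⇝v → ℕₚ.≮⇒≥ λ v<u → lowest (toℕ v) v<u (v , refl , a⇝v)

    lo : Fin n → Fin n
    lo a = proj₁ (component-min a)

    lo-least : ∀ {a v k} → Walk G a v k → lo a Fin.≤ v
    lo-least {a} w = proj₂ (proj₂ (component-min a)) _ (walk⇒reach w)

    lo-≤ : ∀ a → lo a Fin.≤ a
    lo-≤ a = lo-least here

    lo-walk : ∀ a → ∃ λ k → k ≤ d × Walk G a (lo a) k
    lo-walk a with proj₁ (proj₂ (component-min a))
    ... | k , s≤s k≤d , w = k , k≤d , w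

    lo-Adj : ∀ {a b} → Adj G a b → lo a ≡ lo b
    lo-Adj adj = Finₚ.≤-antisym (half adj) (half (swap adj))
      where
      half : ∀ {a b} → Adj G a b → lo a Fin.≤ lo b
      half {b = b} adj = lo-least (step adj (proj₂ (proj₂ (lo-walk b))))

    lo-Walk : ∀ {a b k} → Walk G a b k → lo a ≡ lo b
    lo-Walk here         = refl
    lo-Walk (step adj w) = trans (lo-Adj adj) (lo-Walk w)

    lo-lo : ∀ a → lo (lo a) ≡ lo a
    lo-lo a = sym (lo-Walk (proj₂ (proj₂ (lo-walk a))))

    -- Equal values of `lo` express that two vertices share a component. New parents come along
    -- current edges, whose ends are images of adjacent input vertices, so nothing leaves its
    -- component.
    lo-p     : ∀ k x → lo (p k x) ≡ lo x
    lo-carry : ∀ k a → lo (carry k a) ≡ lo a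
    lo-q     : ∀ k x → lo (q k x) ≡ lo x
    lo-p zero    x = refl
    lo-p (suc k) x = trans (lo-q k (q k x)) (lo-q k x)
    lo-carry zero    a = refl
    lo-carry (suc k) a = trans (lo-p (suc k) (carry k a)) (lo-carry k a)
    lo-q k x with connectUpdate-sel (edges k) (p k) x
    ... | inj₁ eq = trans (cong lo eq) (lo-p k x)
    ... | inj₂ adj with Adj-carry⁻ k adj
    ...   | a , b , adj′ , x≡ , q≡ =
      trans (trans (cong lo q≡) (lo-carry k b))
        (trans (sym (lo-Adj adj′)) (sym (trans (cong lo x≡) (lo-carry k a))))

    -- Within its component, `lo a` has no smaller vertex to move to.
    lo-fixed : (f : Parents n) → (∀ x → lo (f x) ≡ lo x) → (∀ x → f x Fin.≤ x) →
               ∀ a → f (lo a) ≡ lo a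
    lo-fixed f f-lo f-≤ a = Finₚ.≤-antisym (f-≤ (lo a))
      (subst (Fin._≤ f (lo a)) (trans (f-lo (lo a)) (lo-lo a)) (lo-≤ (f (lo a))))

    q-lo : ∀ k a → q k (lo a) ≡ lo a
    q-lo k = lo-fixed (q k) (lo-q k) (q-≤ k)

    p-lo : ∀ k a → p k (lo a) ≡ lo a
    p-lo k = lo-fixed (p k) (lo-p k) (p-≤ k)

    -- Induction along the walk, which need not be shortest: the next vertex `b` has reached `u` one
    -- round earlier.
    carry-dist : ∀ {k a u} → Walk G a u k → u ≡ lo a → carry k a ≡ u
    carry-dist here u≡ = refl
    carry-dist {suc k} {a} (step {w = b} adj w) refl
      with carry-dist w (lo-Adj adj) | Adj-carry⁺ k adj
    ... | b↦ | inj₁ eq   = trans (cong (p (suc k)) (trans eq b↦)) (p-lo (suc k) a)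
    -- The altered edge now joins `carry k a` to the minimum, so `q k` sends it there, and the
    -- shortcut leaves it there.
    ... | b↦ | inj₂ adj′ = trans (cong (q k) qx≡) (q-lo k a)
      where
      x : Fin n
      x = carry k a
      lo≤q : lo a Fin.≤ q k x
      lo≤q = subst (Fin._≤ q k x) (trans (lo-q k x) (lo-carry k a)) (lo-≤ (q k x))
      lo≤x : lo a Fin.≤ x
      lo≤x = subst (Fin._≤ x) (lo-carry k a) (lo-≤ x)
      qx≡ : q k x ≡ lo a
      qx≡ = Finₚ.≤-antisym
        (connectUpdate-≤-adj (edges k) (p k) x (subst (Adj (edges k) x) b↦ adj′) lo≤x)
        lo≤q

    carry-mono : ∀ {j k a} → j ≤ k → carry j a ≡ lo a → carry k a ≡ lo a
    carry-mono j≤k eq with ℕₚ.m≤n⇒m<n∨m≡n j≤k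
    ... | inj₂ refl = eq
    carry-mono {k = suc k} {a} _ eq | inj₁ (s≤s j≤k) =
      trans (cong (p (suc k)) (carry-mono j≤k eq)) (p-lo (suc k) a)

    -- The rounds after the first `d`.

    carry≡lo : ∀ {k} → d ≤ k → ∀ a → carry k a ≡ lo a
    carry≡lo d≤k a with lo-walk a
    ... | j , j≤d , w = carry-mono (ℕₚ.≤-trans j≤d d≤k) (carry-dist w refl)

    Im⇒fixed : ∀ {j} → d ≤ j → ∀ {x} → Im j x → ∀ k → p k x ≡ x
    Im⇒fixed d≤j (a , refl) k rewrite carry≡lo d≤j a = p-lo k a

    Im-final : ∀ {j k} → d ≤ j → d ≤ k → ∀ {x} → Im j x → Im k x
    Im-final d≤j d≤k (a , eq) = a , trans eq (trans (carry≡lo d≤j a) (sym (carry≡lo d≤k a)))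

    -- Both ends of any edge still present would be the same component minimum, which is already its
    -- own parent.
    q≡p : ∀ k → d ≤ k → ∀ x → q k x ≡ p k x
    q≡p k d≤k x with connectUpdate-sel (edges k) (p k) x
    ... | inj₁ eq = eq
    ... | inj₂ adj with Adj-carry⁻ k adj
    ...   | a , b , adj′ , x≡ , q≡ = trans q≡x (sym (Im⇒fixed d≤k (a , x≡) k))
      where
      q≡x : q k x ≡ x
      q≡x = trans (trans q≡ (carry≡lo d≤k b))
              (trans (sym (lo-Adj adj′)) (sym (trans x≡ (carry≡lo d≤k a))))

    p-suc : ∀ k → d ≤ k → ∀ x → p (suc k) x ≡ p k (p k x)
    p-suc k d≤k x = trans (q≡p k d≤k (q k x)) (cong (p k) (q≡p k d≤k x))

    -- After round `d` each round squares the parent map, so the number of levels gained by one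
    -- application grows with `t`. From level `d` on all images coincide and consist of fixed
    -- points.
    p-Im-after : ∀ t j {x} → Im j x → Im (suc (j + t)) (p (t + d) x)
    p-Im-after zero j {x} x∈ rewrite ℕₚ.+-identityʳ j with ℕₚ.<-≤-connex j d
    ... | inj₁ j<d = p-Im-suc d j<d x∈
    ... | inj₂ d≤j = subst (Im (suc j)) (sym (Im⇒fixed d≤j x∈ d))
                       (Im-final d≤j (ℕₚ.m≤n⇒m≤1+n d≤j) x∈)
    p-Im-after (suc t) j {x} x∈ =
      subst (Im (suc (j + suc t))) (sym (p-suc (t + d) (ℕₚ.m≤n+m d t) x))
        -- Two applications gain `2 * (t + 1)` levels; only `t + 2` are kept, as linear growth is
        -- enough.
        (Im-antitone (s≤s (ℕₚ.≤-trans (ℕₚ.≤-reflexive (ℕₚ.+-suc j t)) (ℕₚ.m≤m+n (suc (j + t)) t)))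
          (p-Im-after t (suc (j + t)) (p-Im-after t j x∈)))

    stable : NoParentChanges G (d + d)
    stable x = trans (p-suc (d + d) (ℕₚ.m≤m+n d d) x)
      -- Every vertex lies in `Im 0`, so its parent after `d + d` rounds lies in `Im (suc d)` and is
      -- a component minimum.
      (Im⇒fixed (ℕₚ.n≤1+n d) (p-Im-after d 0 (x , refl)) (d + d))

theorem12 : ∃ λ (c : ℕ) → ∀ (n : ℕ) (G : Graph n) → Loopless G →
    ∃ λ (r : ℕ) → HaltsAfter G r ×
    (∀ d → MaxComponentDiameter G d → r ≤ c * (d + 1))
theorem12 = 2 , λ n G _ → halting G
  where
  bound : ∀ d → suc (d + d) + 1 ≡ 2 * (d + 1)
  bound = solve-∀
  halting : ∀ {n} (G : Graph n) →
    ∃ λ r → HaltsAfter G r × (∀ d → MaxComponentDiameter G d → r ≤ 2 * (d + 1))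
  halting G with terminates G
  ... | k , stops with least (NoParentChanges? G) {k} stops
  ...   | m , still , first = suc m , (m , refl , still , first) , λ d (dist-≤ , _) →
    -- The first unchanging round has `m ≤ d + d`, so `r` is at most `2 * d + 1`, one less than the
    -- stated bound.
    subst (suc m ≤_) (bound d) (ℕₚ.m≤n⇒m≤n+o 1
      (s≤s (ℕₚ.≮⇒≥ λ 2d<m → first (d + d) 2d<m (stable G d dist-≤))))
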